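{- Let $A:\mathcal U^e$ be a sharp exo-type, and suppose that the natural number exo-type $\mathbb N^e$ is cofibrant. Then the exo-type $\mathsf{List}^e(A)$ of finite exo-lists of terms of $A$ is sharp.
   Context: Setting: two-level type theory (2LTT). There is a hierarchy of universes $\mathcal U$ whose terms are called types and which obeys homotopy type theory (with the usual $\prod,\sum,+,\mathbf 1,\mathbf 0,\mathbb N$ and identity type $=$), and a hierarchy of exo-universes $\mathcal U^e$ whose terms are called exo-types, with their own formers $\prod^e,\sum^e,+^e,\mathbf 1^e,\mathbf 0^e,\mathbb N^e$ and exo-equality $=^e$. Every type is also an exo-type. Exo-level inductive exo-types eliminate into arbitrary exo-types, while inductive types eliminate only into types. Axioms: univalence (hence function extensionality) for $=$; function extensionality and uniqueness of identity proofs for $=^e$. An exo-isomorphism $A\cong B$ of exo-types consists of $f:A\to B$, $g:B\to A$ with $f\circ g=^e\mathrm{id}_B$ and $g\circ f=^e\mathrm{id}_A$. An exo-type $A$ is fibrant if there is a type $RA:\mathcal U$ (its fibrant match) with $A\cong RA$. An exo-type $A$ is cofibrant if (1) for any $Y:A\to\mathcal U$ the exo-type $\prod^e_{a:A}Y(a)$ is fibrant, and (2) in that case, if each $Y(a)$ is contractible (with respect to $=$), then so is the fibrant match of $\prod^e_{a:A}Y(a)$. If $A,B$ are fibrant exo-types with exo-isomorphisms $s_A:RA\to A$ and $r_B:B\to RB$ ($RA,RB:\mathcal U$), a map $f:A\to B$ is a fibrant-equivalence if $r_B\circ f\circ s_A:RA\to RB$ is an equivalence of types. An exo-type $A$ is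 sharp if it is cofibrant and there are a type $RA:\mathcal U$ (fibrant replacement) and a map $r:A\to RA$ such that for any $Y:RA\to\mathcal U$ the precomposition map $(-\circ r):\prod_{c:RA}Y(c)\to\prod^e_{a:A}Y(r(a))$ is a fibrant-equivalence. For $A:\mathcal U^e$, $\mathsf{List}^e(A):\mathcal U^e$ is the inductive exo-type with constructors $[\,]^e:\mathsf{List}^e(A)$ and $::^e\;:A\to\mathsf{List}^e(A)\to\mathsf{List}^e(A)$. -}

{-# OPTIONS --with-K #-}
module Defs where

-- Two-level type theory is presented by taking Agda itself as the exo-level and
-- a structure of Tarski universes inside it as the level of types:
--
--   * the exo-universes are the universes Set ℓ, exo-equality is _≡_, and the
--     exo-type formers are Agda's own (so ℕᵉ is ℕ and Listᵉ is List, eliminating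
--     into arbitrary exo-types).  Uniqueness of identity proofs for _≡_ is
--     Axiom K; function extensionality for _≡_ is an explicit assumption.
--   * the universe of types at level ℓ is U ℓ, and El turns a type into an
--     exo-type.  Computation rules of types are exo-equalities, and the
--     inductive types +, 𝟘, ℕ and Id eliminate only into types.

open import Axiom.Extensionality.Propositional using (Extensionality)
open import Data.Product.Base using (Σ; _,_; proj₁; proj₂)
open import Data.Unit.Base using (⊤)
open import Function.Base using (_∘_; id)
open import Level using (Level; _⊔_; Setω) renaming (zero to lzero; suc to lsuc)
open import Relation.Binary.PropositionalEquality using (_≡_; refl; sym; subst; cong-app)

infix 4 _≅_

record _≅_ {a b} (A : Set a) (B : Set b) : Set (a ⊔ b) where
  field
    to      : A → B
    from    : B → A
    to∘from : to ∘ from ≡ id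
    from∘to : from ∘ to ≡ id

≅-refl : ∀ {a} {A : Set a} → A ≅ A
≅-refl = record { to = id ; from = id ; to∘from = refl ; from∘to = refl }

record Types : Setω where
  infixr 5 _+ᵗ_
  field
    U  : (ℓ : Level) → Set (lsuc ℓ)
    El : ∀ {ℓ} → U ℓ → Set ℓ

    -- Each universe is a type of the next one, and universes are cumulative.
    Uᵗ    : (ℓ : Level) → U (lsuc ℓ)
    U-iso : ∀ {ℓ} → El (Uᵗ ℓ) ≅ U ℓ

    Liftᵗ    : ∀ {i} j → U i → U (i ⊔ j)
    Lift-iso : ∀ {i} j (A : U i) → El (Liftᵗ j A) ≅ El A

    -- For the types with an η-rule, introduction, elimination, β and η together
    -- say that El commutes with the former up to exo-isomorphism.
    Πᵗ    : ∀ {i j} (A : U i) → (El A → U j) → U (i ⊔ j)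
    Π-iso : ∀ {i j} (A : U i) (B : El A → U j) →
            El (Πᵗ A B) ≅ ((a : El A) → El (B a))

    Σᵗ    : ∀ {i j} (A : U i) → (El A → U j) → U (i ⊔ j)
    Σ-iso : ∀ {i j} (A : U i) (B : El A → U j) →
            El (Σᵗ A B) ≅ Σ (El A) (λ a → El (B a))

    𝟙ᵗ    : U lzero
    𝟙-iso : El 𝟙ᵗ ≅ ⊤

    𝟘ᵗ     : U lzero
    𝟘-elim : ∀ {k} (C : El 𝟘ᵗ → U k) (x : El 𝟘ᵗ) → El (C x)

    _+ᵗ_   : ∀ {i j} → U i → U j → U (i ⊔ j)
    inl    : ∀ {i j} {A : U i} {B : U j} → El A → El (A +ᵗ B)
    inr    : ∀ {i j} {A : U i} {B : U j} → El B → El (A +ᵗ B)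
    +-elim : ∀ {i j k} {A : U i} {B : U j} (C : El (A +ᵗ B) → U k) →
             ((a : El A) → El (C (inl a))) → ((b : El B) → El (C (inr b))) →
             (x : El (A +ᵗ B)) → El (C x)
    +-β-inl : ∀ {i j k} {A : U i} {B : U j} (C : El (A +ᵗ B) → U k)
              (f : (a : El A) → El (C (inl a))) (g : (b : El B) → El (C (inr b)))
              (a : El A) → +-elim C f g (inl a) ≡ f a
    +-β-inr : ∀ {i j k} {A : U i} {B : U j} (C : El (A +ᵗ B) → U k)
              (f : (a : El A) → El (C (inl a))) (g : (b : El B) → El (C (inr b)))
              (b : El B) → +-elim C f g (inr b) ≡ g b

    ℕᵗ       : U lzero
    zeroᵗ    : El ℕᵗ
    sucᵗ     : El ℕᵗ → El ℕᵗ
    ℕ-elim   : ∀ {k} (C : El ℕᵗ → U k) → El (C zeroᵗ) →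
               ((n : El ℕᵗ) → El (C n) → El (C (sucᵗ n))) →
               (n : El ℕᵗ) → El (C n)
    ℕ-β-zero : ∀ {k} (C : El ℕᵗ → U k) (z : El (C zeroᵗ))
               (s : (n : El ℕᵗ) → El (C n) → El (C (sucᵗ n))) →
               ℕ-elim C z s zeroᵗ ≡ z
    ℕ-β-suc  : ∀ {k} (C : El ℕᵗ → U k) (z : El (C zeroᵗ))
               (s : (n : El ℕᵗ) → El (C n) → El (C (sucᵗ n))) (n : El ℕᵗ) →
               ℕ-elim C z s (sucᵗ n) ≡ s n (ℕ-elim C z s n)

    Idᵗ   : ∀ {i} (A : U i) → El A → El A → U i
    reflᵗ : ∀ {i} {A : U i} (x : El A) → El (Idᵗ A x x)
    J     : ∀ {i k} {A : U i} {x : El A} (C : (y : El A) → El (Idᵗ A x y) → U k) →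
            El (C x (reflᵗ x)) → (y : El A) (p : El (Idᵗ A x y)) → El (C y p)
    J-β   : ∀ {i k} {A : U i} {x : El A} (C : (y : El A) → El (Idᵗ A x y) → U k)
            (c : El (C x (reflᵗ x))) → J C c x (reflᵗ x) ≡ c

  module _ {i j} {A : U i} {B : El A → U j} where
    open _≅_

    app : El (Πᵗ A B) → (a : El A) → El (B a)
    app = to (Π-iso A B)

    lam : ((a : El A) → El (B a)) → El (Πᵗ A B)
    lam = from (Π-iso A B)

    pair : (a : El A) → El (B a) → El (Σᵗ A B)
    pair a b = from (Σ-iso A B) (a , b)

  isContr : ∀ {i} → U i → U i
  isContr A = Σᵗ A λ c → Πᵗ A λ x → Idᵗ A c x

  fiber : ∀ {i j} {A : U i} {B : U j} → (El A → El B) → El B → U (i ⊔ j)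
  fiber {A = A} {B} f b = Σᵗ A λ a → Idᵗ B (f a) b

  isEquiv : ∀ {i j} {A : U i} {B : U j} → (El A → El B) → U (i ⊔ j)
  isEquiv {A = A} {B} f = Πᵗ B λ b → isContr (fiber {A = A} {B} f b)

  Equiv : ∀ {i j} → U i → U j → U (i ⊔ j)
  Equiv A B = Σᵗ (Πᵗ A λ _ → B) λ f → isEquiv {A = A} {B} (app f)

  id-isEquiv : ∀ {i} (A : U i) → El (isEquiv {A = A} {A} id)
  id-isEquiv A = lam λ b → pair (pair b (reflᵗ b)) (lam λ x →
    let open _≅_ (Σ-iso A λ a → Idᵗ A a b) in
    subst (λ y → El (Idᵗ (fib b) (pair b (reflᵗ b)) y)) (cong-app from∘to x)
      (J (λ y p → Idᵗ (fib y) (pair y (reflᵗ y)) (pair (proj₁ (to x)) p))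
         (reflᵗ (pair (proj₁ (to x)) (reflᵗ (proj₁ (to x)))))
         b (proj₂ (to x))))
    where
    fib : El A → U _
    fib = fiber {A = A} {A} id

  id-equiv : ∀ {i} (A : U i) → El (Equiv A A)
  id-equiv A = pair (lam id)
    (subst (λ f → El (isEquiv {A = A} {A} f))
           (sym (cong-app (_≅_.to∘from (Π-iso A λ _ → A)) id)) (id-isEquiv A))

  idtoeqv : ∀ {ℓ} (A B : El (Uᵗ ℓ)) → El (Idᵗ (Uᵗ ℓ) A B) →
            El (Equiv (_≅_.to U-iso A) (_≅_.to U-iso B))
  idtoeqv A = J (λ B _ → Equiv (_≅_.to U-iso A) (_≅_.to U-iso B))
                (id-equiv (_≅_.to U-iso A))

  Univalence : Setω
  Univalence = ∀ {ℓ} (A B : El (Uᵗ ℓ)) →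
    El (isEquiv {A = Idᵗ (Uᵗ ℓ) A B}
                {B = Equiv (_≅_.to U-iso A) (_≅_.to U-iso B)} (idtoeqv A B))

record TwoLevelTypeTheory : Setω where
  field
    types : Types
  open Types types public
  field
    univalence : Univalence
    funextᵉ    : ∀ {a b} → Extensionality a b

  record Fibrant {ℓ} (A : Set ℓ) : Set (lsuc ℓ) where
    field
      match : U ℓ
      iso   : A ≅ El match

  El-fibrant : ∀ {ℓ} (A : U ℓ) → Fibrant (El A)
  El-fibrant A = record { match = A ; iso = ≅-refl }

  FibrantEquivalence : ∀ {a b} {A : Set a} {B : Set b} →
                       Fibrant A → Fibrant B → (A → B) → Set (a ⊔ b)
  FibrantEquivalence FA FB f =
    El (isEquiv {A = match FA} {B = match FB} (to (iso FB) ∘ f ∘ from (iso FA)))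
    where
    open Fibrant
    open _≅_

  -- Cofibrancy and sharpness test against families in every universe U j, so
  -- they live in Setω.
  record Cofibrant {ℓ} (A : Set ℓ) : Setω where
    field
      Π-fibrant : ∀ {j} (Y : A → U j) → Fibrant ((a : A) → El (Y a))
      Π-contr   : ∀ {j} (Y : A → U j) → ((a : A) → El (isContr (Y a))) →
                  El (isContr (Fibrant.match (Π-fibrant Y)))

  record Sharp {ℓ} (A : Set ℓ) : Setω where
    field
      cofibrant   : Cofibrant A
      replacement : U ℓ
      r           : A → El replacement
    open Cofibrant cofibrant
    field
      precomp-equiv : ∀ {j} (Y : El replacement → U j) →
        FibrantEquivalence (El-fibrant (Πᵗ replacement Y)) (Π-fibrant (Y ∘ r))
          (λ h a → app h (r a))

{-# OPTIONS --safe #-}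
{-# OPTIONS --with-K #-}

-- A map r : A → R out of a cofibrant exo-type exhibits R as a fibrant
-- replacement as soon as sections over A extend along r up to Id: applied to
-- identity types, the extension property also gives uniqueness of extensions,
-- since function extensionality holds in types by univalence and in Π over a
-- cofibrant exo-type by its second clause.  The extension property is closed
-- under Σ.  For ℕ, a section g over the numerals extends by internal recursion
-- on n, carrying the whole shifted section k ↦ Y (k + n), which forms a type
-- because ℕ is cofibrant.  Lists are then Σ n, Aⁿ on both levels.
module Submission where

open import Defs
open import Data.List.Base using (List; []; _∷_)
open import Data.Nat.Base using (ℕ; zero; suc)
open import Data.Product.Base using (Σ; _×_; _,_; proj₁; proj₂)
open import Data.Unit.Polymorphic.Base using (⊤; tt)
open import Function.Base using (_∘_; id)
open import Level using (_⊔_; Setω)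
open import Relation.Binary.PropositionalEquality
  using (_≡_; refl; sym; trans; cong; subst; subst₂; cong-app; module ≡-Reasoning)

open _≅_

-- Exo-isomorphisms and exo-powers.

module _ {a b} {A : Set a} {B : Set b} where

  to-from : (e : A ≅ B) (y : B) → to e (from e y) ≡ y
  to-from e = cong-app (to∘from e)

  from-to : (e : A ≅ B) (x : A) → from e (to e x) ≡ x
  from-to e = cong-app (from∘to e)

  ≅-sym : A ≅ B → B ≅ A
  ≅-sym e = record { to = from e ; from = to e ; to∘from = from∘to e ; from∘to = to∘from e }

≅-trans : ∀ {a b c} {A : Set a} {B : Set b} {C : Set c} → A ≅ B → B ≅ C → A ≅ C
≅-trans e f = record
  { to      = to f ∘ to e
  ; from    = from e ∘ from f
  ; to∘from = trans (cong (λ h → to f ∘ h ∘ from f) (to∘from e)) (to∘from f)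
  ; from∘to = trans (cong (λ h → from e ∘ h ∘ to e) (from∘to f)) (from∘to e)
  }

subst-dcong : ∀ {a b} {A : Set a} (B : A → Set b) (f : (x : A) → B x) {x y : A} (e : x ≡ y) →
              subst B e (f x) ≡ f y
subst-dcong B f refl = refl

infixr 8 _^_

_^_ : ∀ {ℓ} → Set ℓ → ℕ → Set ℓ
A ^ zero  = ⊤
A ^ suc n = A × A ^ n

module _ (T : TwoLevelTypeTheory) where
  open TwoLevelTypeTheory T
  open Fibrant
  open Cofibrant

  -- Path algebra in types.

  module _ {i} {A : U i} where

    reflexive : {x y : El A} → x ≡ y → El (Idᵗ A x y)
    reflexive {x} refl = reflᵗ x

    tr : ∀ {k} (P : El A → U k) {x y : El A} → El (Idᵗ A x y) → El (P x) → El (P y)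
    tr P {x} {y} p u = app (J (λ y _ → Πᵗ (P x) λ _ → P y) (lam id) y p) u

    tr-refl : ∀ {k} (P : El A → U k) {x : El A} (u : El (P x)) → tr P (reflᵗ x) u ≡ u
    tr-refl P {x} u = trans (cong (λ h → app h u) (J-β (λ y _ → Πᵗ (P x) λ _ → P y) (lam id)))
                            (cong-app (to-from (Π-iso _ _) id) u)

    symᵗ : {x y : El A} → El (Idᵗ A x y) → El (Idᵗ A y x)
    symᵗ {x} p = tr (λ y → Idᵗ A y x) p (reflᵗ x)

    infixr 5 _∙_

    _∙_ : {x y z : El A} → El (Idᵗ A x y) → El (Idᵗ A y z) → El (Idᵗ A x z)
    _∙_ {x} p q = tr (Idᵗ A x) q p

    ∙-refl : {x y : El A} (p : El (Idᵗ A x y)) → p ∙ reflᵗ y ≡ p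
    ∙-refl {x} p = tr-refl (Idᵗ A x) p

  module _ {i} {A : U i} where

    ∙-symʳ : {x y : El A} (p : El (Idᵗ A x y)) → El (Idᵗ (Idᵗ A x x) (p ∙ symᵗ p) (reflᵗ x))
    ∙-symʳ {x} = J (λ _ p → Idᵗ (Idᵗ A x x) (p ∙ symᵗ p) (reflᵗ x))
      (reflexive (trans (cong (reflᵗ x ∙_) (tr-refl (λ y → Idᵗ A y x) (reflᵗ x))) (∙-refl _))) _

    -- `_∙_` transports along its second path, so it is the right unit law that holds as an
    -- exo-equality. Induction is therefore on `q`, which comes last, and leaves `∙-symʳ`.
    ∙-cancelˡ : {x y z : El A} (p : El (Idᵗ A x y)) (q : El (Idᵗ A x z)) →
                El (Idᵗ (Idᵗ A x z) (p ∙ symᵗ p ∙ q) q)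
    ∙-cancelˡ {x} p = J (λ z q → Idᵗ (Idᵗ A x z) (p ∙ symᵗ p ∙ q) q)
      (subst (λ r → El (Idᵗ (Idᵗ A x x) (p ∙ r) (reflᵗ x))) (sym (∙-refl (symᵗ p))) (∙-symʳ p)) _

    module _ {j} {B : U j} (f : El A → El B) where

      ap : {x y : El A} → El (Idᵗ A x y) → El (Idᵗ B (f x) (f y))
      ap {x} p = tr (λ y → Idᵗ B (f x) (f y)) p (reflᵗ (f x))

      ap-refl : (x : El A) → ap (reflᵗ x) ≡ reflᵗ (f x)
      ap-refl x = tr-refl (λ y → Idᵗ B (f x) (f y)) (reflᵗ (f x))

      ap-reflexive : {x y : El A} (e : x ≡ y) → ap (reflexive e) ≡ reflexive (cong f e)
      ap-reflexive refl = ap-refl _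

      -- Induction on `p`, with `b` free, comes first: `∙-refl` then removes the composite, and an
      -- induction on `α` remains.
      fiber-path : {x y : El A} {b : El B} (α : El (Idᵗ A x y)) (p : El (Idᵗ B (f y) b)) →
                   El (Idᵗ (fiber {A = A} {B} f b) (pair x (ap α ∙ p)) (pair y p))
      fiber-path {x} {y} α = J (λ b p → Idᵗ (fiber {A = A} {B} f b) (pair x (ap α ∙ p)) (pair y p))
        (subst (λ r → El (Idᵗ (fiber {A = A} {B} f (f y)) (pair x r) (pair y (reflᵗ (f y)))))
          (sym (∙-refl (ap α)))
          (J (λ y α → Idᵗ (fiber {A = A} {B} f (f y)) (pair x (ap α)) (pair y (reflᵗ (f y))))
            (reflexive (cong (pair x) (ap-refl x))) y α)) _

  module _ {i j} {A : U i} {B : El A → U j} where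

    fst : El (Σᵗ A B) → El A
    fst z = proj₁ (to (Σ-iso A B) z)

    snd : (z : El (Σᵗ A B)) → El (B (fst z))
    snd z = proj₂ (to (Σ-iso A B) z)

    to-pair : (x : El A) (y : El (B x)) → to (Σ-iso A B) (pair x y) ≡ (x , y)
    to-pair x y = to-from (Σ-iso A B) (x , y)

    fst-pair : (x : El A) (y : El (B x)) → fst (pair x y) ≡ x
    fst-pair x y = cong proj₁ (to-pair x y)

    pair-η : (z : El (Σᵗ A B)) → pair (fst z) (snd z) ≡ z
    pair-η = from-to (Σ-iso A B)

    app-lam : (f : (x : El A) → El (B x)) → app (lam f) ≡ f
    app-lam = to-from (Π-iso A B)

    app-lam-at : (f : (x : El A) → El (B x)) (x : El A) → app (lam f) x ≡ f x
    app-lam-at f = cong-app (app-lam f)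

    lam-app : (h : El (Πᵗ A B)) → lam (app h) ≡ h
    lam-app = from-to (Π-iso A B)

  -- Contractible types and equivalences.

  module _ {i} {A : U i} where

    centre : El (isContr A) → El A
    centre = fst

    contract : (c : El (isContr A)) (x : El A) → El (Idᵗ A (centre c) x)
    contract c = app (snd c)

    isContr-path : El (isContr A) → (x y : El A) → El (Idᵗ A x y)
    isContr-path c x y = symᵗ (contract c x) ∙ contract c y

    isContr-retract : ∀ {j} {B : U j} (s : El A → El B) (ρ : El B → El A) →
                      ((x : El A) → El (Idᵗ A (ρ (s x)) x)) → El (isContr B) → El (isContr A)
    isContr-retract s ρ H c = pair (ρ (fst c)) (lam λ x → ap ρ (app (snd c) (s x)) ∙ H x)

  isContr-≅ : ∀ {i j} {A : U i} {B : U j} → El A ≅ El B → El (isContr B) → El (isContr A)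
  isContr-≅ e = isContr-retract (to e) (from e) (reflexive ∘ from-to e)

  -- The fibre of f over b is a retract of the fibre of id over b.
  quasiInverse⇒isEquiv : ∀ {i j} {A : U i} {B : U j} (f : El A → El B) (g : El B → El A) →
    ((x : El A) → El (Idᵗ A (g (f x)) x)) → ((y : El B) → El (Idᵗ B (f (g y)) y)) →
    El (isEquiv {A = A} {B} f)
  quasiInverse⇒isEquiv {A = A} {B} f g η ε = lam λ b →
    isContr-retract (s b) (ρ b) (H b) (app (id-isEquiv B) b)
    where
    s₀ : ∀ {b} → Σ (El A) (λ x → El (Idᵗ B (f x) b)) → El (fiber {A = B} {B} id b)
    -- The leading inverse of `ε (f x)` is there to cancel the `ε` that `ρ₀` prepends; the remainder
    -- `ap f (η x) ∙ p` has the shape that `fiber-path` takes back to `p`.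
    s₀ (x , p) = pair (f x) (symᵗ (ε (f x)) ∙ ap f (η x) ∙ p)

    ρ₀ : ∀ {b} → Σ (El B) (λ y → El (Idᵗ B y b)) → El (fiber {A = A} {B} f b)
    ρ₀ (y , q) = pair (g y) (ε y ∙ q)

    s : ∀ b → El (fiber {A = A} {B} f b) → El (fiber {A = B} {B} id b)
    s b z = s₀ (to (Σ-iso _ _) z)

    ρ : ∀ b → El (fiber {A = B} {B} id b) → El (fiber {A = A} {B} f b)
    ρ b z = ρ₀ (to (Σ-iso _ _) z)

    H : ∀ b (z : El (fiber {A = A} {B} f b)) → El (Idᵗ (fiber {A = A} {B} f b) (ρ b (s b z)) z)
    H b z = reflexive (cong ρ₀ (to-pair _ _))
          ∙ ap (pair (g (f (fst z)))) (∙-cancelˡ (ε (f (fst z))) (ap f (η (fst z)) ∙ snd z))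
          ∙ fiber-path f (η (fst z)) (snd z)
          ∙ reflexive (pair-η z)

  -- Function extensionality for types

  module _ {i} (X : U i) where

    postcomp : ∀ {ℓ} {W V : U ℓ} → (El W → El V) → El (Πᵗ X λ _ → W) → El (Πᵗ X λ _ → V)
    postcomp f h = lam (f ∘ app h)

    PostcompEquiv : ∀ {ℓ} (W V : U ℓ) → (El W → El V) → U (i ⊔ ℓ)
    PostcompEquiv W V f = isEquiv {A = Πᵗ X λ _ → W} {Πᵗ X λ _ → V} (postcomp {W = W} {V} f)

    -- Path induction reduces to the identity equivalence, where postcomposition is the identity by
    -- η for `Πᵗ`.
    postcomp-idtoeqv : ∀ {ℓ} (A B : El (Uᵗ ℓ)) (p : El (Idᵗ (Uᵗ ℓ) A B)) →
      El (PostcompEquiv (to U-iso A) (to U-iso B) (app (fst (idtoeqv A B p))))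
    postcomp-idtoeqv {ℓ} A = J
      (λ B p → PostcompEquiv (to U-iso A) (to U-iso B) (app (fst (idtoeqv A B p))))
      (subst (λ e → El (PostcompEquiv W W (app (fst e)))) (sym (J-β _ (id-equiv W)))
        (subst (λ f → El (PostcompEquiv W W f))
          (sym (trans (cong app (fst-pair _ _)) (app-lam id)))
          (subst (λ f → El (isEquiv {A = Πᵗ X λ _ → W} {Πᵗ X λ _ → W} f))
            (funextᵉ (sym ∘ lam-app))
            (id-isEquiv (Πᵗ X λ _ → W)))))
      where
      W = to U-iso A

    -- By univalence `e` is joined by a path to some `idtoeqv`, found at the centre of its fibre, so
    -- the previous case transports to `e`. Univalence speaks of codes in `El (Uᵗ ℓ)`, hence the
    -- rewriting along `U-iso`.
    postcomp-equiv : ∀ {ℓ} (W V : U ℓ) (e : El (Equiv W V)) → El (PostcompEquiv W V (app (fst e)))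
    postcomp-equiv W V = subst₂ (λ W V → (e : El (Equiv W V)) → El (PostcompEquiv W V (app (fst e))))
      (to-from U-iso W) (to-from U-iso V) λ e →
        let z = centre (app (univalence (from U-iso W) (from U-iso V)) e)
        in tr (λ e → PostcompEquiv _ _ (app (fst e))) (snd z) (postcomp-idtoeqv _ _ (fst z))

    postcomp-isEquiv : ∀ {ℓ} {W V : U ℓ} (f : El W → El V) →
                       El (isEquiv {A = W} {V} f) → El (PostcompEquiv W V f)
    postcomp-isEquiv {W = W} {V} f w =
      subst (λ f → El (PostcompEquiv W V f)) (trans (cong app (fst-pair _ _)) (app-lam f))
        (postcomp-equiv W V
          (pair (lam f) (subst (λ f → El (isEquiv {A = W} {V} f)) (sym (app-lam f)) w)))

  -- Π A P is a retract of the fibre, over the canonical map A → Lift A, of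
  -- postcomposition with the equivalence Σ A P → Lift A.  Lifting A puts both
  -- sides in one universe, as univalence requires.
  Π-isContr : ∀ {i j} (A : U i) (P : El A → U j) →
              ((x : El A) → El (isContr (P x))) → El (isContr (Πᵗ A P))
  Π-isContr {i} {j} A P c = isContr-retract (s₀ ∘ app) (ρ₀ ∘ to (Σ-iso _ _)) H
    (app (postcomp-isEquiv A f f-isEquiv) ι)
    where
    W V : U (i ⊔ j)
    W = Σᵗ A P
    V = Liftᵗ j A

    L : El V ≅ El A
    L = Lift-iso j A

    f : El W → El V
    f = from L ∘ fst

    f-isEquiv : El (isEquiv {A = W} {V} f)
    -- Contractibility of the `P x` enters here: the inverse `g` attaches their centres.
    f-isEquiv = quasiInverse⇒isEquiv f g
      (λ w → reflexive (cong (λ x → pair x (centre (c x))) (to-from L (fst w)))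
           ∙ ap (pair (fst w)) (contract (c (fst w)) (snd w))
           ∙ reflexive (pair-η w))
      (λ v → reflexive (trans (cong (from L) (fst-pair _ _)) (from-to L v)))
      where
      g : El V → El W
      g v = pair (to L v) (centre (c (to L v)))

    ι : El (Πᵗ A λ _ → V)
    ι = lam (from L)

    F : U (i ⊔ j)
    F = fiber {A = Πᵗ A λ _ → W} {Πᵗ A λ _ → V} (postcomp A f) ι

    graph : ((x : El A) → El (P x)) → El (Πᵗ A λ _ → W)
    graph φ = lam λ x → pair x (φ x)

    app-graph : ∀ φ x → app (graph φ) x ≡ pair x (φ x)
    app-graph φ = app-lam-at λ x → pair x (φ x)

    graph-over-ι : ∀ φ → postcomp A f (graph φ) ≡ ι
    graph-over-ι φ = cong lam (funextᵉ λ x →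
      trans (cong f (app-graph φ x)) (cong (from L) (fst-pair x (φ x))))

    s₀ : ((x : El A) → El (P x)) → El F
    s₀ φ = pair (graph φ) (reflexive (graph-over-ι φ))

    at : El A → El (Πᵗ A λ _ → V) → El A
    at x v = to L (app v x)

    at-postcomp : ∀ x w → at x (postcomp A f w) ≡ fst (app w x)
    at-postcomp x w = trans (cong (to L) (app-lam-at (f ∘ app w) x)) (to-from L _)

    at-ι : ∀ x → at x ι ≡ x
    at-ι x = trans (cong (to L) (app-lam-at (from L) x)) (to-from L x)

    path : ∀ x w → El (Idᵗ (Πᵗ A λ _ → V) (postcomp A f w) ι) → El (Idᵗ A (fst (app w x)) x)
    path x w q = subst₂ (λ y z → El (Idᵗ A y z)) (at-postcomp x w) (at-ι x) (ap (at x) q)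

    ρ₀ : Σ (El (Πᵗ A λ _ → W)) (λ w → El (Idᵗ (Πᵗ A λ _ → V) (postcomp A f w) ι)) → El (Πᵗ A P)
    ρ₀ (w , q) = lam λ x → tr P (path x w q) (snd (app w x))

    subst₂-reflexive : {x y x' y' : El A} (e : x ≡ y) (e₁ : x ≡ x') (e₂ : y ≡ y') →
      subst₂ (λ y z → El (Idᵗ A y z)) e₁ e₂ (reflexive e) ≡ reflexive (trans (sym e₁) (trans e e₂))
    subst₂-reflexive refl refl refl = refl

    -- Axiom K allows `e` to be any proof, such as the long composite `e'` below, rather than the
    -- one induced by the equation of pairs.
    tr-reflexive : ∀ {x} {y : El (P x)} (t : Σ (El A) (El ∘ P)) → t ≡ (x , y) →
                   (e : proj₁ t ≡ x) → tr P (reflexive e) (proj₂ t) ≡ y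
    tr-reflexive _ refl refl = tr-refl P _

    -- The path stored by `s₀` comes from an exo-equality, and `ap` and `subst₂` keep it of that
    -- form, so the transport collapses.
    ρ₀-graph : ∀ φ x → tr P (path x (graph φ) (reflexive (graph-over-ι φ))) (snd (app (graph φ) x)) ≡ φ x
    ρ₀-graph φ x = begin
      tr P (path x w (reflexive (graph-over-ι φ))) (snd (app w x))
        ≡⟨ cong (λ q → tr P (subst₂ (λ y z → El (Idᵗ A y z)) (at-postcomp x w) (at-ι x) q)
                          (snd (app w x)))
                (ap-reflexive (at x) (graph-over-ι φ)) ⟩
      tr P (subst₂ (λ y z → El (Idᵗ A y z)) (at-postcomp x w) (at-ι x) (reflexive e)) (snd (app w x))
        ≡⟨ cong (λ q → tr P q (snd (app w x))) (subst₂-reflexive e (at-postcomp x w) (at-ι x)) ⟩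
      tr P (reflexive e') (snd (app w x))
        ≡⟨ tr-reflexive _ (trans (cong (to (Σ-iso A P)) (app-graph φ x)) (to-pair x (φ x))) e' ⟩
      φ x ∎
      where
      open ≡-Reasoning
      w  = graph φ
      e  = cong (at x) (graph-over-ι φ)
      e' = trans (sym (at-postcomp x w)) (trans e (at-ι x))

    H : (h : El (Πᵗ A P)) → El (Idᵗ (Πᵗ A P) (ρ₀ (to (Σ-iso _ _) (s₀ (app h)))) h)
    H h = reflexive (begin
      ρ₀ (to (Σ-iso _ _) (s₀ (app h)))                       ≡⟨ cong ρ₀ (to-pair _ _) ⟩
      ρ₀ (graph (app h) , reflexive (graph-over-ι (app h)))  ≡⟨ cong lam (funextᵉ (ρ₀-graph (app h))) ⟩
      lam (app h)                                            ≡⟨ lam-app h ⟩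
      h ∎)
      where open ≡-Reasoning

  -- Cofibrant exo-types

  El-cofibrant : ∀ {ℓ} (R : U ℓ) → Cofibrant (El R)
  El-cofibrant R = record
    { Π-fibrant = λ Y → record { match = Πᵗ R Y ; iso = ≅-sym (Π-iso R Y) }
    ; Π-contr   = Π-isContr R
    }

  -- The singletons `S a` of elements with a path to `v a` are contractible, hence so is their
  -- product over `A`. Pairing `u` with `p`, and `v` with reflexivity, gives two points of that
  -- product; `π` carries the path between them to the required one.
  cofibrant-funext : ∀ {ℓ j} {A : Set ℓ} (cof : Cofibrant A) {Y : A → U j}
    (u v : (a : A) → El (Y a)) → ((a : A) → El (Idᵗ (Y a) (u a) (v a))) →
    El (Idᵗ (match (Π-fibrant cof Y)) (to (iso (Π-fibrant cof Y)) u) (to (iso (Π-fibrant cof Y)) v))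
  cofibrant-funext {ℓ} {j} {A} cof {Y} u v p =
    subst₂ (λ x y → El (Idᵗ (match (Π-fibrant cof Y)) x y))
      (π-section u p) (π-section v (reflᵗ ∘ v))
      (ap π (isContr-path (Π-contr cof S (λ a → app (id-isEquiv (Y a)) (v a))) _ _))
    where
    S : A → U j
    S a = fiber {A = Y a} {Y a} id (v a)

    π : El (match (Π-fibrant cof S)) → El (match (Π-fibrant cof Y))
    π z = to (iso (Π-fibrant cof Y)) λ a → fst (from (iso (Π-fibrant cof S)) z a)

    π-section : (w : (a : A) → El (Y a)) (q : (a : A) → El (Idᵗ (Y a) (w a) (v a))) →
      π (to (iso (Π-fibrant cof S)) λ a → pair (w a) (q a)) ≡ to (iso (Π-fibrant cof Y)) w
    π-section w q = cong (to (iso (Π-fibrant cof Y))) (funextᵉ λ a →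
      trans (cong fst (cong-app (from-to (iso (Π-fibrant cof S)) _) a)) (fst-pair (w a) (q a)))

  Π-cong-≅ : ∀ {a b c} {A : Set a} {B : A → Set b} {C : A → Set c} →
             ((x : A) → B x ≅ C x) → ((x : A) → B x) ≅ ((x : A) → C x)
  Π-cong-≅ e = record
    { to      = λ f x → to (e x) (f x)
    ; from    = λ f x → from (e x) (f x)
    ; to∘from = funextᵉ λ f → funextᵉ λ x → to-from (e x) (f x)
    ; from∘to = funextᵉ λ f → funextᵉ λ x → from-to (e x) (f x)
    }

  Π-reindex-≅ : ∀ {a b c} {A : Set a} {B : Set b} (e : A ≅ B) (C : B → Set c) →
                ((y : B) → C y) ≅ ((x : A) → C (to e x))
  Π-reindex-≅ e C = record
    { to      = λ f x → f (to e x)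
    ; from    = λ f y → subst C (to-from e y) (f (from e y))
    ; to∘from = funextᵉ λ f → funextᵉ λ x → transfer f (from-to e x) (to-from e (to e x))
    ; from∘to = funextᵉ λ f → funextᵉ λ y → subst-dcong C f (to-from e y)
    }
    where
    -- Axiom K stands in for the triangle identity between the two inverse laws of `e`: the two
    -- equations are matched independently.
    transfer : (f : ∀ x → C (to e x)) → ∀ {x x'} → x ≡ x' → (q : to e x ≡ to e x') →
               subst C q (f x) ≡ f x'
    transfer f refl refl = refl

  cofibrant-≅ : ∀ {ℓ} {A B : Set ℓ} → A ≅ B → Cofibrant A → Cofibrant B
  cofibrant-≅ e cof = record
    { Π-fibrant = λ Y → record
        { match = match (Π-fibrant cof (Y ∘ to e))
        ; iso   = ≅-trans (Π-reindex-≅ e (El ∘ Y)) (iso (Π-fibrant cof (Y ∘ to e)))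
        }
    ; Π-contr = λ Y c → Π-contr cof (Y ∘ to e) (c ∘ to e)
    }

  cofibrant-⊤ : ∀ {ℓ} → Cofibrant (⊤ {ℓ})
  cofibrant-⊤ {ℓ} = record
    { Π-fibrant = λ Y → record
        -- The lift only adjusts the level, since functions out of `⊤ {ℓ}` live at `ℓ ⊔ j`.
        { match = Liftᵗ ℓ (Y tt)
        ; iso   = ≅-trans
            (record { to = λ f → f tt ; from = λ y _ → y ; to∘from = refl ; from∘to = refl })
            (≅-sym (Lift-iso ℓ (Y tt)))
        }
    ; Π-contr = λ Y c → isContr-≅ (Lift-iso ℓ (Y tt)) (c tt)
    }

  cofibrant-Σ : ∀ {a b} {A : Set a} {B : A → Set b} →
                Cofibrant A → ((x : A) → Cofibrant (B x)) → Cofibrant (Σ A B)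
  cofibrant-Σ {A = A} {B} cofA cofB = record
    { Π-fibrant = λ Y → record
        { match = match (Π-fibrant cofA (inner Y))
        ; iso   = ≅-trans
            (≅-trans
              (record { to = λ f x y → f (x , y) ; from = λ f (x , y) → f x y
                      ; to∘from = refl ; from∘to = refl })
              (Π-cong-≅ λ x → iso (Π-fibrant (cofB x) λ y → Y (x , y))))
            (iso (Π-fibrant cofA (inner Y)))
        }
    ; Π-contr = λ Y c → Π-contr cofA (inner Y) λ x → Π-contr (cofB x) _ λ y → c (x , y)
    }
    where
    inner : ∀ {j} → (Σ A B → U j) → A → U _
    inner Y x = match (Π-fibrant (cofB x) λ y → Y (x , y))

  cofibrant-^ : ∀ {ℓ} {A : Set ℓ} → Cofibrant A → (n : ℕ) → Cofibrant (A ^ n)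
  cofibrant-^ cof zero    = cofibrant-⊤
  cofibrant-^ cof (suc n) = cofibrant-Σ cof λ _ → cofibrant-^ cof n

  -- Extension of sections along a map into a type

  -- The β-rule is pointwise and up to `Idᵗ`, so it refers to no fibrant match of the sections over
  -- `A`.
  record Extension {a b} (A : Set a) (R : U b) : Setω where
    field
      unit     : A → El R
      extend   : ∀ {j} (Y : El R → U j) → ((x : A) → El (Y (unit x))) → (c : El R) → El (Y c)
      extend-β : ∀ {j} (Y : El R → U j) (g : (x : A) → El (Y (unit x))) (x : A) →
                 El (Idᵗ (Y (unit x)) (extend Y g (unit x)) (g x))
  open Extension

  sharp⇒extension : ∀ {ℓ} {A : Set ℓ} (S : Sharp A) → Extension A (Sharp.replacement S)
  sharp⇒extension {A = A} S = record
    { unit     = r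
    ; extend   = λ Y g → app (fst (solution Y g))
    ; extend-β = λ Y g x →
        subst₂ (λ y z → El (Idᵗ (Y (r x)) y z))
          (cong-app (from-to (iso (Π-fibrant cofibrant (Y ∘ r))) _) x)
          (cong-app (from-to (iso (Π-fibrant cofibrant (Y ∘ r))) g) x)
          -- The path lies in the fibrant match; decoding and evaluating at `x` makes it pointwise.
          (ap (λ m → from (iso (Π-fibrant cofibrant (Y ∘ r))) m x) (snd (solution Y g)))
    }
    where
    open Sharp S
    solution : ∀ {j} (Y : El replacement → U j) (g : (x : A) → El (Y (r x))) → _
    solution Y g = centre (app (precomp-equiv Y) (to (iso (Π-fibrant cofibrant (Y ∘ r))) g))

  extension⇒sharp : ∀ {ℓ} {A : Set ℓ} {R : U ℓ} → Cofibrant A → Extension A R → Sharp A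
  extension⇒sharp {A = A} {R} cof E = record
    { cofibrant     = cof
    ; replacement   = R
    ; r             = unit E
    ; precomp-equiv = λ Y →
        let e     = iso (Π-fibrant cof (Y ∘ unit E))
            P h   = to e λ x → app h (unit E x)
            Q b   = lam (extend E Y (from e b))
        in quasiInverse⇒isEquiv P Q
          (λ h → cofibrant-funext (El-cofibrant R) (extend E Y (from e (P h))) (app h)
                   -- Two sections over `R` that agree on the image of `A` agree everywhere, by
                   -- extending the path between them.
                   (extend E (λ c → Idᵗ (Y c) (extend E Y (from e (P h)) c) (app h c)) λ x →
                     extend-β E Y (from e (P h)) x ∙ reflexive (cong-app (from-to e _) x))
                 ∙ reflexive (lam-app h))
          (λ b → cofibrant-funext cof (λ x → app (Q b) (unit E x)) (from e b) (λ x →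
                     reflexive (app-lam-at _ (unit E x)) ∙ extend-β E Y (from e b) x)
                 ∙ reflexive (to-from e b))
    }

  extension-≅ : ∀ {a a' b} {A : Set a} {A' : Set a'} {R : U b} →
                A ≅ A' → Extension A R → Extension A' R
  extension-≅ e E = record
    { unit     = unit E ∘ from e
    ; extend   = λ Y g → extend E Y (from (reindex Y) g)
    ; extend-β = λ Y g x → extend-β E Y (from (reindex Y) g) (from e x)
                         ∙ reflexive (cong-app (to-from (reindex Y) g) x)
    }
    where
    reindex : ∀ {j} (Y : El _ → U j) → _
    reindex Y = Π-reindex-≅ (≅-sym e) (λ x → El (Y (unit E x)))

  subst-extension : ∀ {a b} {A : Set a} {R R' : U b} → R ≡ R' → Extension A R → Extension A R'
  subst-extension refl E = E

  -- Extension for the unit, sums and natural numbers.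

  extension-⊤ : ∀ {ℓ} → Extension (⊤ {ℓ}) (Liftᵗ ℓ 𝟙ᵗ)
  extension-⊤ {ℓ} = record
    { unit     = λ _ → from e _
    ; extend   = λ Y g c → subst (El ∘ Y) (from-to e c) (g tt)
    ; extend-β = λ Y g x → reflexive (subst-K (El ∘ Y) (from-to e (from e _)) (g tt))
    }
    where
    e = ≅-trans (Lift-iso ℓ 𝟙ᵗ) 𝟙-iso

    subst-K : ∀ {a b} {A : Set a} (B : A → Set b) {x : A} (p : x ≡ x) (y : B x) → subst B p y ≡ y
    subst-K B refl y = refl

  -- Curry and extend twice: over each `x`, extending along `F x` gives a point of the product over
  -- `S (unit E x)`; these products form a family of types over all of `R`, so `E` extends the
  -- resulting section. Thus `F` is asked for only over the image of `unit E`.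
  extension-Σ : ∀ {a b c d} {A : Set a} {B : A → Set b} {R : U c} {S : El R → U d}
    (E : Extension A R) → ((x : A) → Extension (B x) (S (unit E x))) → Extension (Σ A B) (Σᵗ R S)
  extension-Σ {A = A} {B} {R} {S} E F = record
    { unit     = λ (x , y) → pair (unit E x) (unit (F x) y)
    ; extend   = λ Y g z → subst (El ∘ Y) (pair-η z) (ext Y g (fst z) (snd z))
    ; extend-β = λ Y g (x , y) →
        reflexive (subst-pair Y (ext Y g) (to-pair _ _) (pair-η _))
        ∙ ap (λ h → app h (unit (F x) y)) (extend-β E _ _ x)
        ∙ reflexive (app-lam-at _ (unit (F x) y))
        ∙ extend-β (F x) _ _ y
    }
    where
    ext : ∀ {j} (Y : El (Σᵗ R S) → U j) →
          ((p : Σ A B) → El (Y (pair (unit E (proj₁ p)) (unit (F (proj₁ p)) (proj₂ p))))) →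
          (c : El R) (s : El (S c)) → El (Y (pair c s))
    ext Y g c s = app (extend E (λ c → Πᵗ (S c) λ s → Y (pair c s))
      (λ x → lam (extend (F x) (λ s → Y (pair (unit E x) s)) λ y → g (x , y))) c) s

    subst-pair : ∀ {j} (Y : El (Σᵗ R S) → U j) (h : ∀ c (s : El (S c)) → El (Y (pair c s)))
      {t : Σ (El R) (El ∘ S)} {c : El R} {s : El (S c)} → t ≡ (c , s) →
      (q : pair (proj₁ t) (proj₂ t) ≡ pair c s) →
      subst (El ∘ Y) q (h (proj₁ t) (proj₂ t)) ≡ h c s
    subst-pair Y h refl refl = refl

  -- With an accumulator, a section of k ↦ Y (shift k n) precomposed with suc is
  -- definitionally a section of k ↦ Y (shift k (sucᵗ n)).
  shift : ℕ → El ℕᵗ → El ℕᵗ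
  shift zero    n = n
  shift (suc k) n = shift k (sucᵗ n)

  shift-suc : ∀ k n → shift k (sucᵗ n) ≡ sucᵗ (shift k n)
  shift-suc zero    n = refl
  shift-suc (suc k) n = shift-suc k (sucᵗ n)

  extension-ℕ : Cofibrant ℕ → Extension ℕ ℕᵗ
  extension-ℕ cof = record
    { unit     = λ k → shift k zeroᵗ
    -- `tail Y g n` holds the values at `n` and its successors; position zero is the value at `n`
    -- itself.
    ; extend   = λ Y g n → tail Y g n zero
    ; extend-β = λ Y g k → reflexive (trans (tail-shift Y g k zeroᵗ) (cong-app (tail-zero Y g) k))
    }
    where
    module _ {j} (Y : El ℕᵗ → U j) (g : (k : ℕ) → El (Y (shift k zeroᵗ))) where
      Tail : El ℕᵗ → U j
      Tail n = match (Π-fibrant cof λ k → Y (shift k n))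

      e : ∀ n → ((k : ℕ) → El (Y (shift k n))) ≅ El (Tail n)
      e n = iso (Π-fibrant cof λ k → Y (shift k n))

      step : (n : El ℕᵗ) → El (Tail n) → El (Tail (sucᵗ n))
      step n m = to (e (sucᵗ n)) (from (e n) m ∘ suc)

      tail : (n : El ℕᵗ) (k : ℕ) → El (Y (shift k n))
      tail n = from (e n) (ℕ-elim Tail (to (e zeroᵗ) g) step n)

      tail-zero : tail zeroᵗ ≡ g
      tail-zero = trans (cong (from (e zeroᵗ)) (ℕ-β-zero Tail (to (e zeroᵗ) g) step))
                        (from-to (e zeroᵗ) g)

      tail-suc : ∀ n → tail (sucᵗ n) ≡ tail n ∘ suc
      tail-suc n = trans (cong (from (e (sucᵗ n))) (ℕ-β-suc Tail (to (e zeroᵗ) g) step n))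
                         (from-to (e (sucᵗ n)) _)

      -- Induction on `k` with `n` general moves one successor at a time from the base point to the
      -- position. At `n = zeroᵗ` the right side is `g k`, by `tail-zero`.
      tail-shift : ∀ k n → tail (shift k n) zero ≡ tail n k
      tail-shift zero    n = refl
      tail-shift (suc k) n = trans (tail-shift k (sucᵗ n)) (cong-app (tail-suc n) k)

  -- Internal vectors and exo-lists.

  module _ {ℓ} (R : U ℓ) where

    Vec-step : El (Uᵗ ℓ) → El (Uᵗ ℓ)
    Vec-step V = from U-iso (Σᵗ R λ _ → to U-iso V)

    -- `ℕ-elim` reaches only types, so the recursion runs in the code `Uᵗ ℓ` and is decoded by
    -- `U-iso`; its equations hold as exo-equalities of types.
    Vecᵗ : El ℕᵗ → U ℓ
    Vecᵗ n = to U-iso (ℕ-elim (λ _ → Uᵗ ℓ) (from U-iso (Liftᵗ ℓ 𝟙ᵗ)) (λ _ → Vec-step) n)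

    Vec-zero : Vecᵗ zeroᵗ ≡ Liftᵗ ℓ 𝟙ᵗ
    Vec-zero = trans (cong (to U-iso) (ℕ-β-zero _ _ _)) (to-from U-iso _)

    Vec-suc : ∀ n → Vecᵗ (sucᵗ n) ≡ Σᵗ R λ _ → Vecᵗ n
    Vec-suc n = trans (cong (to U-iso) (ℕ-β-suc _ _ _ n)) (to-from U-iso _)

  -- The index `shift n zeroᵗ` is the image of `n` under the unit of `extension-ℕ`, as `extension-Σ`
  -- requires of its fibres.
  extension-^ : ∀ {ℓ} {A : Set ℓ} {R : U ℓ} → Extension A R →
                (n : ℕ) → Extension (A ^ n) (Vecᵗ R (shift n zeroᵗ))
  extension-^ {R = R} E zero    = subst-extension (sym (Vec-zero R)) extension-⊤
  extension-^ {R = R} E (suc n) = subst-extension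
    -- `shift` accumulates inside while `Vec-suc` needs an outer `sucᵗ`, so `shift-suc` moves it out
    -- first.
    (sym (trans (cong (Vecᵗ R) (shift-suc n zeroᵗ)) (Vec-suc R _)))
    (extension-Σ E λ _ → extension-^ E n)

  Σ^≅List : ∀ {ℓ} {A : Set ℓ} → Σ ℕ (A ^_) ≅ List A
  Σ^≅List {A = A} = record
    { to      = λ (n , v) → toList n v
    ; from    = fromList
    ; to∘from = funextᵉ toList-fromList
    ; from∘to = funextᵉ λ (n , v) → fromList-toList n v
    }
    where
    toList : ∀ n → A ^ n → List A
    toList zero    _       = []
    toList (suc n) (x , v) = x ∷ toList n v

    cons : A → Σ ℕ (A ^_) → Σ ℕ (A ^_)
    cons x (n , v) = suc n , x , v

    fromList : List A → Σ ℕ (A ^_)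
    fromList []       = zero , tt
    fromList (x ∷ xs) = cons x (fromList xs)

    toList-fromList : ∀ xs → toList (proj₁ (fromList xs)) (proj₂ (fromList xs)) ≡ xs
    toList-fromList []       = refl
    toList-fromList (x ∷ xs) = cong (x ∷_) (toList-fromList xs)

    fromList-toList : ∀ n v → fromList (toList n v) ≡ (n , v)
    fromList-toList zero    _       = refl
    fromList-toList (suc n) (x , v) = cong (cons x) (fromList-toList n v)

proposition3p4 : (T : TwoLevelTypeTheory) → let open TwoLevelTypeTheory T in
    ∀ {ℓ} (A : Set ℓ) → Sharp A → Cofibrant ℕ → Sharp (List A)
proposition3p4 T A sharpA cofℕ = extension⇒sharp T
  (cofibrant-≅ T (Σ^≅List T)
    (cofibrant-Σ T cofℕ (cofibrant-^ T (TwoLevelTypeTheory.Sharp.cofibrant sharpA))))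
  (extension-≅ T (Σ^≅List T)
    -- The family is given explicitly because its values at numerals do not determine it.
    (extension-Σ T {S = Vecᵗ T _} (extension-ℕ T cofℕ) (extension-^ T (sharp⇒extension T sharpA))))
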